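{- The sequence $\left(|I_k(123,132,213)|\right)_{k\ge 0}$ enumerates the Pascal triangle read by diagonals, offset by two elements, in the following sense: the term for $k=0$ is $\binom{1}{1}$, and the terms for $k=1,2,3,\dots$ are the binomial coefficients $\binom{n}{m}$ with $n\ge 2$ and $m\ge 0$ (including those equal to $0$ because $m>n$), listed in increasing order of $n+m$, and among those with the same value of $n+m$ in increasing order of $n$. Furthermore \[\sum_{k\ge 0}|I_k(123,132,213)|\,x^k=1+x+\sum_{d\ge 3}x^{1+\binom{d-1}{2}}\sum_{n=2}^{d}\binom{n}{d-n}x^{n-2}.\]
   Context: A permutation of length $n$ is a word $\pi=\pi_1\cdots\pi_n$ containing each of $1,\dots,n$ exactly once. The sum of permutations $\rho=\rho_1\cdots\rho_n$ and $\tau=\tau_1\cdots\tau_m$ is the permutation $\rho\oplus\tau=\rho_1\cdots\rho_n(n+\tau_1)\cdots(n+\tau_m)$ of length $n+m$. A permutation is decomposable if it equals $\rho\oplus\tau$ for some non-empty permutations $\rho,\tau$; a non-empty permutation that is not decomposable is indecomposable. An inversion of $\pi$ is a pair $(i,j)$ with $i<j$ and $\pi_i>\pi_j$. A permutation $\pi$ contains a permutation (pattern) $\tau=\tau_1\cdots\tau_m$ if there are indices $i_1<\dots<i_m$ such that $\pi_{i_1},\dots,\pi_{i_m}$ is order-isomorphic to $\tau_1,\dots,\tau_m$; otherwise $\pi$ avoids $\tau$. $I_k(\tau_1,\dots,\tau_r)$ denotes the (finite) set of all indecomposable permutations, of any length, with exactly $k$ inversions that avoid all of $\tau_1,\dots,\tau_r$.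 -}

module Defs where

open import Algebra.Bundles.Raw using (RawSemiring)
import Algebra.Definitions.RawSemiring as RawSemiringDefs
open import Data.Fin as Fin using (Fin)
import Data.Fin.Properties as Fin
open import Data.List
  using (List; []; _∷_; _++_; map; foldr; length; lookup; filter; upTo; applyUpTo;
         allFin; cartesianProduct)
open import Data.List.Membership.Propositional using (_∈_)
open import Data.List.Relation.Binary.Permutation.Propositional using (_↭_)
open import Data.List.Relation.Unary.All using (All)
open import Data.List.Relation.Unary.Unique.Propositional using (Unique)
open import Data.Nat using (ℕ; zero; suc; _+_; _*_; _∸_; _≤_; _<_; _<?_)
open import Data.Nat.ListAction using (sum)
open import Data.Product using (Σ; _×_; _,_; ∃-syntax)
open import Data.Product.Relation.Binary.Lex.Strict using (×-Lex)
open import Function using (_on_; _⇔_)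
open import Level using (0ℓ)
open import Relation.Binary.PropositionalEquality using (_≡_; _≢_; _≗_)
open import Relation.Nullary using (¬_)
open import Relation.Nullary.Decidable using (_×-dec_)

-- P has exactly n elements; in particular P is finite.
HasCardinality : {A : Set} → (A → Set) → ℕ → Set
HasCardinality P n = ∃[ xs ] Unique xs × (∀ x → x ∈ xs ⇔ P x) × length xs ≡ n

Word : Set
Word = List ℕ

IsPermutation : Word → Set
IsPermutation π = π ↭ applyUpTo suc (length π)

_⊕_ : Word → Word → Word
ρ ⊕ τ = ρ ++ map (length ρ +_) τ

Decomposable : Word → Set
Decomposable π =
  ∃[ ρ ] ∃[ τ ] IsPermutation ρ × IsPermutation τ × ρ ≢ [] × τ ≢ [] × π ≡ ρ ⊕ τ

Indecomposable : Word → Set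
Indecomposable π = π ≢ [] × ¬ Decomposable π

inversions : (π : Word) → List (Fin (length π) × Fin (length π))
inversions π =
  filter (λ (i , j) → (i Fin.<? j) ×-dec (lookup π j <? lookup π i))
         (cartesianProduct (allFin (length π)) (allFin (length π)))

Contains : Word → Word → Set
Contains π τ =
  Σ (Fin (length τ) → Fin (length π)) λ f →
    (∀ a b → a Fin.< b → f a Fin.< f b) ×
    (∀ a b → lookup τ a < lookup τ b ⇔ lookup π (f a) < lookup π (f b))

Avoids : Word → Word → Set
Avoids π τ = ¬ Contains π τ

I : ℕ → List Word → Word → Set
I k τs π =
  IsPermutation π × Indecomposable π × length (inversions π) ≡ k × All (Avoids π) τs

-- `Below (n , m) (n′ , m′)`: the pairs are compared by n + m, ties being broken by n.
Below : ℕ × ℕ → ℕ × ℕ → Set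
Below = ×-Lex _≡_ _<_ _<_ on λ (n , m) → (n + m , n)

-- `e` lists, in increasing order and without repetition, all (n , m) with n ≥ 2.
ListsByDiagonals : (ℕ → ℕ × ℕ) → Set
ListsByDiagonals e =
  (∀ i j → i < j → Below (e i) (e j)) ×
  (∀ n m → 2 ≤ n ⇔ (∃[ i ] e i ≡ (n , m)))

-- Formal power series with coefficients in ℕ: `f k` is the coefficient of xᵏ.
Series : Set
Series = ℕ → ℕ

const : ℕ → Series
const c zero    = c
const c (suc _) = 0

X : Series
X 1 = 1
X _ = 0

seriesRawSemiring : RawSemiring 0ℓ 0ℓ
seriesRawSemiring = record
  { Carrier = Series
  ; _≈_     = _≗_
  ; _+_     = λ f g k → f k + g k
  ; _*_     = λ f g k → sum (map (λ i → f i * g (k ∸ i)) (upTo (suc k)))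
  ; 0#      = const 0
  ; 1#      = const 1
  }

open RawSemiring seriesRawSemiring public
  using () renaming (_+_ to _+ₛ_; _*_ to _*ₛ_; 0# to 0ₛ; 1# to 1ₛ)
open RawSemiringDefs seriesRawSemiring public
  using () renaming (_^_ to _^ₛ_)

-- The sum of F n over s ≤ n ≤ t.
∑ : ℕ → ℕ → (ℕ → Series) → Series
∑ s t F = foldr (λ n S → F n +ₛ S) 0ₛ (map (s +_) (upTo (suc t ∸ s)))

-- The sum of F n over all n ≥ s converges to S in the usual topology on formal
-- power series: every coefficient of the partial sums is eventually that of S.
SumsTo : ℕ → (ℕ → Series) → Series → Set
SumsTo s F S = ∀ k → ∃[ N ] (∀ t → N ≤ t → ∑ s t F k ≡ S k)

{-# OPTIONS --safe #-}
module Submission where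

-- A permutation avoids 123, 132 and 213 if and only if no entry is smaller than an entry at least
-- two places to its right: given such entries at positions i < k, any entry strictly between the
-- positions completes one of the three patterns, while in each pattern the first value is below
-- the last (avoids⇒noFarAscent, noFarAscent⇒avoids).  Splitting off the largest value, such a
-- permutation is seen to be a skew sum of copies of 1 and 12 (noFarAscent⇒layered).  Let N be the
-- number of summands, of which m are 12.  Then the length is N + m; the only pairs of positions
-- that are not inversions are those inside the summands 12, so that the number k of inversions
-- satisfies k + m = (N + m) C 2 (layered-inversions); there are N C m such permutations
-- (layeredWords-length); and they are indecomposable when N is at least 2, because then the last
-- entry is smaller than the first, while a sum has its last entry larger than its first.  For
-- N = 1 the permutation 1 is indecomposable and 12 is not.
--
-- List the pairs (n , m) with n at least 2 by n + m and then by n.  A step along a diagonal lowers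
-- m by one and keeps n + m, and a step to the next diagonal, from (s , 0) to (2 , s - 1), raises
-- (n + m) C 2 by s and m by s - 1.  Hence the i-th pair satisfies (i + 1) + m = (n + m) C 2
-- (diagonal-C2), and it is the only pair that does.  The indecomposable avoiders with i + 1
-- inversions are thus exactly the n C m skew sums that belong to the i-th pair, and the
-- permutation 1 is the only one without inversions (I-cardinality).
--
-- For the generating series, the term for (d , n) on the right-hand side is n C (d - n) at the
-- degree 1 + (d - 1) C 2 + (n - 2).  Writing m = d - n, this degree plus m equals d C 2, so it is
-- one more than the position of (n , m) in the list.  Each degree from 2 on therefore receives
-- exactly one term, the expected one (series-hit, series-miss).  The diagonal d = 2, which
-- consists of (2 , 0) only, and the permutation 1 account for the summands X and 1.

open import Defs
open import Data.Fin as Fin using (Fin; zero; suc)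
open import Data.Fin.Patterns using (0F; 1F; 2F)
import Data.Fin.Properties as Fin
open import Data.List
  using (List; []; _∷_; _++_; _∷ʳ_; map; length; lookup; filter; allFin; applyUpTo; upTo;
         cartesianProduct; initLast; _∷ʳ′_; foldr)
open import Data.List.Membership.Propositional using (_∈_)
open import Data.List.Membership.Propositional.Properties
  using (∈-lookup; ∈-map⁻; ∈-map⁺; ∈-++⁻; ∈-++⁺ˡ; ∈-++⁺ʳ)
open import Data.List.Properties
  using (applyUpTo-∷ʳ; length-applyUpTo; map-++; ++-assoc; filter-++; filter-≐; filter-all;
         filter-reject; length-++; length-map; map-∘; map-cong; map-tabulate; tabulate-lookup;
         ∷-injectiveˡ; ∷-injectiveʳ)
open import Data.List.Relation.Binary.Permutation.Propositional
  using (_↭_; ↭⇒↭ₛ; ↭-refl; ↭-sym; ↭-trans; ↭-reflexive; swap)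
open import Data.List.Relation.Binary.Permutation.Propositional.Properties
  using (All-resp-↭; ∈-resp-↭; ↭-length; drop-∷; ∷↭∷ʳ; ++⁺ʳ)
import Data.List.Relation.Binary.Permutation.Setoid.Properties as PermSetoid
open import Data.List.Relation.Unary.All as All using (All; []; _∷_)
import Data.List.Relation.Unary.All.Properties as All
open import Data.List.Relation.Unary.AllPairs using ([]; _∷_)
open import Data.List.Relation.Unary.Any using (here; there)
open import Data.List.Relation.Unary.Unique.Propositional using (Unique)
import Data.List.Relation.Unary.Unique.Propositional.Properties as Unique
open import Data.Nat
open import Data.Nat.Combinatorics using (_C_; nC1≡n; nCk+nC[k+1]≡[n+1]C[k+1]; k>n⇒nCk≡0)
open import Data.Nat.ListAction using (sum)
open import Data.Nat.Properties
open import Data.Nat.Tactic.RingSolver using (solve-∀)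
open import Data.Product.Relation.Binary.Lex.Strict using (×-transitive)
open import Data.Product using (Σ; _×_; _,_; ∃-syntax; proj₁; proj₂; uncurry)
open import Data.Sum using (inj₁; inj₂; [_,_]′)
open import Function using (_∘_; id; _⇔_; mk⇔; Equivalence)
open import Relation.Binary using (tri<; tri≈; tri>)
open import Relation.Binary.PropositionalEquality
open import Relation.Nullary using (¬_; yes; no; contradiction)
open import Relation.Nullary.Decidable using (_×-dec_)
open import Relation.Unary using (Decidable)

-- Permutations of 1, ..., n

-- The identity permutation 1 2 ... n.
1⋯_ : ℕ → Word
1⋯ n = applyUpTo suc n

1⋯-snoc : ∀ n → (1⋯ n) ∷ʳ suc n ≡ 1⋯ suc n
1⋯-snoc = applyUpTo-∷ʳ suc

cons-max : ∀ {n w} → w ↭ 1⋯ n → suc n ∷ w ↭ 1⋯ suc n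
cons-max {n} {w} p =
  ↭-trans (∷↭∷ʳ (suc n) w) (↭-trans (++⁺ʳ (suc n ∷ []) p) (↭-reflexive (1⋯-snoc n)))

uncons-max : ∀ {n w} → suc n ∷ w ↭ 1⋯ suc n → w ↭ 1⋯ n
uncons-max {n} p =
  drop-∷ (↭-trans p (↭-sym (cons-max ↭-refl)))

entries≤ : ∀ {n w} → w ↭ 1⋯ n → All (_≤ n) w
entries≤ {n} p = All-resp-↭ (↭-sym p) (All.applyUpTo⁺₁ suc n id)

length-perm : ∀ {n w} → w ↭ 1⋯ n → length w ≡ n
length-perm {n} p = trans (↭-length p) (length-applyUpTo suc n)

perm-unique : ∀ {n w} → w ↭ 1⋯ n → Unique w
perm-unique {n} p =
  PermSetoid.Unique-resp-↭ (setoid ℕ) (↭⇒↭ₛ (↭-sym p))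
    (Unique.applyUpTo⁺₁ suc n λ i<j _ → <⇒≢ i<j ∘ suc-injective)

-- A weakly largest entry in front can only be the maximum n, and removing it leaves a
-- permutation of 1, ..., n - 1.
dominant-head : ∀ {x w} → IsPermutation (x ∷ w) → All (_≤ x) w →
                x ≡ suc (length w) × IsPermutation w
dominant-head {x} {w} p x≥w = x≡n , uncons-max (subst (λ z → z ∷ w ↭ 1⋯ suc (length w)) x≡n p)
  where
  n∈ : suc (length w) ∈ x ∷ w
  n∈ = ∈-resp-↭ (↭-trans (cons-max ↭-refl) (↭-sym p)) (here refl)
  x≡n : x ≡ suc (length w)
  x≡n = ≤-antisym (All.head (entries≤ p)) (All.lookup (≤-refl ∷ x≥w) n∈)

-- Avoiding 123, 132 and 213 means having no far ascent

-- No entry is smaller than an entry two or more places to its right; the index j witnesses the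
-- gap between i and k.
NoFarAscent : Word → Set
NoFarAscent π =
  ∀ (i j k : Fin (length π)) → i Fin.< j → j Fin.< k → ¬ lookup π i < lookup π k

unique-lookup : ∀ {w : Word} → Unique w →
                ∀ (i j : Fin (length w)) → i Fin.< j → lookup w i ≢ lookup w j
unique-lookup (x∉w ∷ _) zero    (suc j) _       = All.lookup x∉w (∈-lookup j)
unique-lookup (_ ∷ u)   (suc i) (suc j) (s<s p) = unique-lookup u i j p

increasing : (g : Fin 3 → ℕ) → g 0F < g 1F → g 1F < g 2F → ∀ r s → r Fin.< s → g r < g s
increasing g p q 0F 1F _ = p
increasing g p q 0F 2F _ = <-trans p q
increasing g p q 1F 2F _ = q
increasing g p q 1F 1F (s<s ())
increasing g p q 2F 1F (s<s ())
increasing g p q 2F 2F (s<s (s<s ()))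

increasing⁻ : (g : Fin 3 → ℕ) → g 0F < g 1F → g 1F < g 2F → ∀ r s → g r < g s → r Fin.< s
increasing⁻ g p q r s gr<gs with Fin.<-cmp r s
... | tri< r<s _ _    = r<s
... | tri≈ _ refl _   = contradiction gr<gs (<-irrefl refl)
... | tri> _ _ s<r    = contradiction gr<gs (<-asym (increasing g p q s r s<r))

-- Two triples have the same relative order as soon as one involution sorts both.  Being
-- involutive spares a separate inverse, and suffices for 123, 132 and 213.
same-order : (g h : Fin 3 → ℕ) (σ : Fin 3 → Fin 3) → (∀ a → σ (σ a) ≡ a) →
             g (σ 0F) < g (σ 1F) → g (σ 1F) < g (σ 2F) →
             h (σ 0F) < h (σ 1F) → h (σ 1F) < h (σ 2F) →
             ∀ a b → g a < g b ⇔ h a < h b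
same-order g h σ σσ g₁ g₂ h₁ h₂ a b = mk⇔ (transfer g h g₁ g₂ h₁ h₂) (transfer h g h₁ h₂ g₁ g₂)
  where
  transfer : (g h : Fin 3 → ℕ) →
             g (σ 0F) < g (σ 1F) → g (σ 1F) < g (σ 2F) →
             h (σ 0F) < h (σ 1F) → h (σ 1F) < h (σ 2F) →
             g a < g b → h a < h b
  transfer g h g₁ g₂ h₁ h₂ ga<gb =
    subst₂ (λ a b → h a < h b) (σσ a) (σσ b)
      (increasing (h ∘ σ) h₁ h₂ (σ a) (σ b)
        (increasing⁻ (g ∘ σ) g₁ g₂ (σ a) (σ b)
          (subst₂ (λ a b → g a < g b) (sym (σσ a)) (sym (σσ b)) ga<gb)))

-- The function on three indices with the given values.
triple : ∀ {A : Set} → A → A → A → Fin 3 → A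
triple x y z 0F = x
triple x y z 1F = y
triple x y z 2F = z

p123 p132 p213 : Word
p123 = 1 ∷ 2 ∷ 3 ∷ []
p132 = 1 ∷ 3 ∷ 2 ∷ []
p213 = 2 ∷ 1 ∷ 3 ∷ []

module _ (π : Word) {i j k : Fin (length π)} (i<j : i Fin.< j) (j<k : j Fin.< k) where

  private
    at : Fin 3 → Fin (length π)
    at = triple i j k

    occurrence : ∀ x y z → let τ = x ∷ y ∷ z ∷ [] in
                 (∀ a b → lookup τ a < lookup τ b ⇔ lookup π (at a) < lookup π (at b)) →
                 Contains π τ
    occurrence _ _ _ iso = at , increasing (Fin.toℕ ∘ at) i<j j<k , iso

  contains-123 : lookup π i < lookup π j → lookup π j < lookup π k → Contains π p123
  contains-123 p q = occurrence 1 2 3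
    (same-order (lookup p123) (lookup π ∘ at) id (λ _ → refl) ≤-refl ≤-refl p q)

  contains-132 : lookup π i < lookup π k → lookup π k < lookup π j → Contains π p132
  contains-132 p q = occurrence 1 3 2
    (same-order (lookup p132) (lookup π ∘ at) (triple 0F 2F 1F)
      (λ { 0F → refl ; 1F → refl ; 2F → refl }) ≤-refl ≤-refl p q)

  contains-213 : lookup π j < lookup π i → lookup π i < lookup π k → Contains π p213
  contains-213 p q = occurrence 2 1 3
    (same-order (lookup p213) (lookup π ∘ at) (triple 1F 0F 2F)
      (λ { 0F → refl ; 1F → refl ; 2F → refl }) ≤-refl ≤-refl p q)

-- The forbidden patterns.
patterns : List Word
patterns = p123 ∷ p132 ∷ p213 ∷ []

-- If i < j < k and the entry at i is below the entry at k, then the entry at j lies below,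
-- between or above these two, and the three entries form a 213, a 123 or a 132.
avoids⇒noFarAscent : ∀ {π} → Unique π → All (Avoids π) patterns → NoFarAscent π
avoids⇒noFarAscent {π} u (no123 ∷ no132 ∷ no213 ∷ []) i j k i<j j<k πi<πk
  with <-cmp (lookup π i) (lookup π j) | <-cmp (lookup π j) (lookup π k)
... | tri> _ _ πj<πi | _              = no213 (contains-213 π i<j j<k πj<πi πi<πk)
... | tri≈ _ eq _    | _              = unique-lookup u i j i<j eq
... | tri< _ _ _     | tri≈ _ eq _    = unique-lookup u j k j<k eq
... | tri< πi<πj _ _ | tri< πj<πk _ _ = no123 (contains-123 π i<j j<k πi<πj πj<πk)
... | tri< _ _ _     | tri> _ _ πk<πj = no132 (contains-132 π i<j j<k πi<πk πk<πj)

-- In each of the three patterns the first value is below the last.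
noFarAscent⇒avoids : ∀ {π} → NoFarAscent π → All (Avoids π) patterns
noFarAscent⇒avoids {π} nfa = avoid (s<s z<s) ∷ avoid (s<s z<s) ∷ avoid (s<s (s<s z<s)) ∷ []
  where
  avoid : ∀ {x y z} → x < z → Avoids π (x ∷ y ∷ z ∷ [])
  avoid x<z (f , mono , iso) =
    nfa (f 0F) (f 1F) (f 2F) (mono 0F 1F z<s) (mono 1F 2F (s<s z<s))
        (Equivalence.to (iso 0F 2F) x<z)

-- Permutations without far ascents are the skew sums of 1s and 12s

-- Layered N m w: the word w is a skew sum of N permutations, of which m are equal to 12 and the
-- others to 1.  Its length is N + m.  Each constructor puts a new summand, carrying the largest
-- values, in front.
data Layered : ℕ → ℕ → Word → Set where
  []     : Layered 0 0 []
  single : ∀ {N m w} → Layered N m w → Layered (suc N) m (suc (N + m) ∷ w)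
  double : ∀ {N m w} → Layered N m w →
           Layered (suc N) (suc m) (suc (N + m) ∷ suc (suc (N + m)) ∷ w)

layered-perm : ∀ {N m w} → Layered N m w → w ↭ 1⋯ (N + m)
layered-perm []                 = ↭-refl
layered-perm (single l)         = cons-max (layered-perm l)
layered-perm (double {N} {m} {w} l) =
  subst (λ n → suc (N + m) ∷ suc (suc (N + m)) ∷ w ↭ 1⋯ suc n) (sym (+-suc N m))
    (↭-trans (swap _ _ ↭-refl) (cons-max (cons-max (layered-perm l))))

layered-length : ∀ {N m w} → Layered N m w → length w ≡ N + m
layered-length = length-perm ∘ layered-perm

layered-< : ∀ {N m w} → Layered N m w → All (_< suc (N + m)) w
layered-< = All.map s≤s ∘ entries≤ ∘ layered-perm

layered⇒noFarAscent : ∀ {N m w} → Layered N m w → NoFarAscent w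
layered⇒noFarAscent (single l) zero (suc j) (suc k) _ _ =
  <-asym (All.lookup (layered-< l) (∈-lookup k))
layered⇒noFarAscent (single l) (suc i) (suc j) (suc k) (s<s p) (s<s q) =
  layered⇒noFarAscent l i j k p q
layered⇒noFarAscent (double l) zero (suc j) (suc (suc k)) _ _ =
  <-asym (All.lookup (layered-< l) (∈-lookup k))
layered⇒noFarAscent (double l) zero (suc j) (suc zero) _ (s<s ())
layered⇒noFarAscent (double l) (suc zero) (suc (suc j)) (suc (suc k)) _ _ =
  <-asym (m<n⇒m<1+n (All.lookup (layered-< l) (∈-lookup k)))
layered⇒noFarAscent (double l) (suc (suc i)) (suc (suc j)) (suc (suc k))
                    (s<s (s<s p)) (s<s (s<s q)) =
  layered⇒noFarAscent l i j k p q
layered⇒noFarAscent (double l) (suc i) (suc zero) _ (s<s ())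
layered⇒noFarAscent (double l) (suc i) (suc (suc j)) (suc zero) _ (s<s ())

noFarAscent-tail : ∀ {x w} → NoFarAscent (x ∷ w) → NoFarAscent w
noFarAscent-tail nfa i j k p q = nfa (suc i) (suc j) (suc k) (s<s p) (s<s q)

all-lookup : ∀ {P : ℕ → Set} w → (∀ i → P (lookup w i)) → All P w
all-lookup []      f = []
all-lookup (_ ∷ w) f = f zero ∷ all-lookup w (f ∘ suc)

-- Everything from the third entry on is bounded by the first.
far-≤ : ∀ {x y w} → NoFarAscent (x ∷ y ∷ w) → All (_≤ x) w
far-≤ nfa = all-lookup _ λ k → ≮⇒≥ (nfa zero (suc zero) (suc (suc k)) z<s (s<s z<s))

-- A skew sum of any numbers of 1s and 12s.
LayeredWord : Word → Set
LayeredWord w = ∃[ N ] ∃[ m ] Layered N m w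

layered-single : ∀ {w} → LayeredWord w → LayeredWord (suc (length w) ∷ w)
layered-single {w} (N , m , l) =
  suc N , m , subst (λ n → Layered (suc N) m (suc n ∷ w)) (sym (layered-length l)) (single l)

layered-double : ∀ {w} → LayeredWord w →
                 LayeredWord (suc (length w) ∷ suc (suc (length w)) ∷ w)
layered-double {w} (N , m , l) =
  suc N , suc m ,
  subst (λ n → Layered (suc N) (suc m) (suc n ∷ suc (suc n) ∷ w))
        (sym (layered-length l)) (double l)

dominant-single : ∀ {x w} → IsPermutation (x ∷ w) → All (_≤ x) w →
                  (IsPermutation w → LayeredWord w) → LayeredWord (x ∷ w)
dominant-single p x≥w rec with refl , p′ ← dominant-head p x≥w = layered-single (rec p′)

dominant-double : ∀ {x y w} → IsPermutation (x ∷ y ∷ w) → x ≤ y → All (_≤ x) w →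
                  (IsPermutation w → LayeredWord w) → LayeredWord (x ∷ y ∷ w)
dominant-double {x} {y} p x≤y x≥w rec
  with refl , p′ ← dominant-head (↭-trans (swap y x ↭-refl) p)
                     (x≤y ∷ All.map (λ z≤x → ≤-trans z≤x x≤y) x≥w)
  with refl , p″ ← dominant-head p′ x≥w = layered-double (rec p″)

-- Without far ascents the first entry bounds all entries but possibly the second.  The larger of
-- the first two entries is therefore n: if it is the first, a summand 1 splits off, and otherwise
-- the first one is n - 1 and a summand 12 splits off.
noFarAscent⇒layered : ∀ w → IsPermutation w → NoFarAscent w → LayeredWord w
noFarAscent⇒layered []          _ _   = 0 , 0 , []
noFarAscent⇒layered (x ∷ [])    p _   = dominant-single p [] (λ _ → 0 , 0 , [])
noFarAscent⇒layered (x ∷ y ∷ w) p nfa =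
  [ (λ y≤x → dominant-single p (y≤x ∷ far-≤ nfa) λ p′ →
       noFarAscent⇒layered (y ∷ w) p′ (noFarAscent-tail {x} {y ∷ w} nfa))
  , (λ x≤y → dominant-double p x≤y (far-≤ nfa) λ p′ →
       noFarAscent⇒layered w p′ (noFarAscent-tail {y} {w} (noFarAscent-tail {x} {y ∷ w} nfa)))
  ]′ (≤-total y x)

-- Indecomposability

entries>0 : ∀ {n w} → w ↭ 1⋯ n → All (0 <_) w
entries>0 {n} p = All-resp-↭ (↭-sym p) (All.applyUpTo⁺₂ suc n λ _ → z<s)

-- With at least two summands the last entry lies in a later summand than the first entry, hence
-- below it.
layered-ends : ∀ {N m x z} ys → Layered (suc (suc N)) m (x ∷ ys ∷ʳ z) → z < x
layered-ends []       (single l) = All.head (layered-< l)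
layered-ends (_ ∷ ys) (single l) = All.lookup (layered-< l) (∈-++⁺ʳ (_ ∷ ys) (here refl))
layered-ends []       (double ())
layered-ends (_ ∷ ys) (double l) = All.lookup (layered-< l) (∈-++⁺ʳ ys (here refl))

-- In a sum of non-empty permutations the first entry is at most the length of the first
-- permutation, and the last entry exceeds it.
sum-ends : ∀ {w} → Decomposable w → ∃[ x ] ∃[ ys ] ∃[ z ] w ≡ x ∷ ys ∷ʳ z × x < z
sum-ends ([]    , _ , _  , _  , ρ≢[] , _    , _) = contradiction refl ρ≢[]
sum-ends (x ∷ ρ , τ , pρ , pτ , _    , τ≢[] , w≡) with initLast τ
... | []      = contradiction refl τ≢[]
... | τ′ ∷ʳ′ t =
  x , ρ ++ map (r +_) τ′ , r + t ,
  trans w≡ (cong (x ∷_) (trans (cong (ρ ++_) (map-++ (r +_) τ′ (t ∷ [])))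
                               (sym (++-assoc ρ (map (r +_) τ′) _)))) ,
  ≤-<-trans (All.head (entries≤ pρ)) (m<m+n r 0<t)
  where
  r = length (x ∷ ρ)
  0<t : 0 < t
  0<t = All.lookup (entries>0 pτ) (∈-++⁺ʳ τ′ (here refl))

layered-indecomposable : ∀ {N m w} → Layered (suc (suc N)) m w → Indecomposable w
layered-indecomposable l = (λ { refl → case-[] l }) , λ d → ends l (sum-ends d)
  where
  case-[] : ∀ {N m} → ¬ Layered (suc N) m []
  case-[] ()
  ends : ∀ {N m w} → Layered (suc (suc N)) m w → ¬ (∃[ x ] ∃[ ys ] ∃[ z ] w ≡ x ∷ ys ∷ʳ z × x < z)
  ends l (x , ys , z , refl , x<z) = <-asym x<z (layered-ends ys l)

[1]-indecomposable : Indecomposable (1 ∷ [])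
[1]-indecomposable = (λ ()) , λ d → short (sum-ends d)
  where
  short : ¬ (∃[ x ] ∃[ ys ] ∃[ z ] 1 ∷ [] ≡ x ∷ ys ∷ʳ z × x < z)
  short (x , []    , z , () , _)
  short (x , _ ∷ _ , z , () , _)

12-decomposable : Decomposable (1 ∷ 2 ∷ [])
12-decomposable = 1 ∷ [] , 1 ∷ [] , ↭-refl , ↭-refl , (λ ()) , (λ ()) , refl

-- Counting inversions

length-filter-map : ∀ {A B : Set} {P : B → Set} (P? : Decidable P) (f : A → B) xs →
                    length (filter P? (map f xs)) ≡ length (filter (P? ∘ f) xs)
length-filter-map P? f []       = refl
length-filter-map P? f (x ∷ xs) with P? (f x)
... | yes _ = cong suc (length-filter-map P? f xs)
... | no  _ = length-filter-map P? f xs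

length-filter-product : ∀ {A B : Set} {P : A × B → Set} (P? : Decidable P) xs ys →
  length (filter P? (cartesianProduct xs ys)) ≡
  sum (map (λ x → length (filter (λ y → P? (x , y)) ys)) xs)
length-filter-product P? []       ys = refl
length-filter-product P? (x ∷ xs) ys = begin
  length (filter P? (map (x ,_) ys ++ cartesianProduct xs ys))
    ≡⟨ cong length (filter-++ P? (map (x ,_) ys) _) ⟩
  length (filter P? (map (x ,_) ys) ++ filter P? (cartesianProduct xs ys))
    ≡⟨ length-++ (filter P? (map (x ,_) ys)) ⟩
  length (filter P? (map (x ,_) ys)) + length (filter P? (cartesianProduct xs ys))
    ≡⟨ cong₂ _+_ (length-filter-map P? (x ,_) ys) (length-filter-product P? xs ys) ⟩
  _ ∎
  where open ≡-Reasoning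

allFin-suc : ∀ n → allFin (suc n) ≡ zero ∷ map suc (allFin n)
allFin-suc n = cong (zero ∷_) (sym (map-tabulate id suc))

-- The predicate selecting the inversions among all pairs of positions.
Inversion : (w : Word) → Fin (length w) × Fin (length w) → Set
Inversion w (i , j) = i Fin.< j × lookup w j < lookup w i

inversion? : (w : Word) → Decidable (Inversion w)
inversion? w (i , j) = (i Fin.<? j) ×-dec (lookup w j <? lookup w i)

-- The number of inversions whose left position is i.
row : (w : Word) → Fin (length w) → ℕ
row w i = length (filter (λ j → inversion? w (i , j)) (allFin (length w)))

length-inversions : ∀ w → length (inversions w) ≡ sum (map (row w) (allFin (length w)))
length-inversions w = length-filter-product (inversion? w) (allFin (length w)) (allFin (length w))

-- The first position is never the right end of an inversion.
row-drop : ∀ x w (i : Fin (length (x ∷ w))) →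
  row (x ∷ w) i ≡ length (filter (λ j → inversion? (x ∷ w) (i , suc j)) (allFin (length w)))
row-drop x w i = begin
  length (filter (λ j → inversion? (x ∷ w) (i , j)) (allFin (suc (length w))))
    ≡⟨ cong (λ js → length (filter (λ j → inversion? (x ∷ w) (i , j)) js)) (allFin-suc (length w)) ⟩
  length (filter (λ j → inversion? (x ∷ w) (i , j)) (zero ∷ map suc (allFin (length w))))
    ≡⟨ cong length (filter-reject (λ j → inversion? (x ∷ w) (i , j))
                      {zero} {map suc (allFin (length w))} (λ ())) ⟩
  length (filter (λ j → inversion? (x ∷ w) (i , j)) (map suc (allFin (length w))))
    ≡⟨ length-filter-map (λ j → inversion? (x ∷ w) (i , j)) suc (allFin (length w)) ⟩
  _ ∎
  where open ≡-Reasoning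

row-suc : ∀ x w (i : Fin (length w)) → row (x ∷ w) (suc i) ≡ row w i
row-suc x w i = trans (row-drop x w (suc i))
  (cong length (filter-≐ (λ j → inversion? (x ∷ w) (suc i , suc j)) (λ j → inversion? w (i , j))
    ((λ { (s<s p , q) → p , q }) , (λ { (p , q) → s<s p , q })) (allFin (length w))))

row-zero : ∀ x w → row (x ∷ w) zero ≡ length (filter (_<? x) w)
row-zero x w = begin
  row (x ∷ w) zero
    ≡⟨ row-drop x w zero ⟩
  length (filter (λ j → inversion? (x ∷ w) (zero , suc j)) (allFin (length w)))
    ≡⟨ cong length (filter-≐ (λ j → inversion? (x ∷ w) (zero , suc j)) ((_<? x) ∘ lookup w)
        (proj₂ , (λ q → z<s , q)) (allFin (length w))) ⟩
  length (filter ((_<? x) ∘ lookup w) (allFin (length w)))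
    ≡⟨ length-filter-map (_<? x) (lookup w) (allFin (length w)) ⟨
  length (filter (_<? x) (map (lookup w) (allFin (length w))))
    ≡⟨ cong (length ∘ filter (_<? x)) (trans (map-tabulate id (lookup w)) (tabulate-lookup w)) ⟩
  length (filter (_<? x) w) ∎
  where open ≡-Reasoning

-- The inversions of x ∷ w are those of w together with one for each entry of w below x.
inversions-∷ : ∀ x w →
  length (inversions (x ∷ w)) ≡ length (filter (_<? x) w) + length (inversions w)
inversions-∷ x w = begin
  length (inversions (x ∷ w))
    ≡⟨ length-inversions (x ∷ w) ⟩
  sum (map (row (x ∷ w)) (allFin (suc (length w))))
    ≡⟨ cong (sum ∘ map (row (x ∷ w))) (allFin-suc (length w)) ⟩
  row (x ∷ w) zero + sum (map (row (x ∷ w)) (map suc (allFin (length w))))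
    ≡⟨ cong₂ _+_ (row-zero x w) (cong sum (sym (map-∘ (allFin (length w))))) ⟩
  length (filter (_<? x) w) + sum (map (row (x ∷ w) ∘ suc) (allFin (length w)))
    ≡⟨ cong (λ rs → length (filter (_<? x) w) + sum rs)
            (map-cong (row-suc x w) (allFin (length w))) ⟩
  length (filter (_<? x) w) + sum (map (row w) (allFin (length w)))
    ≡⟨ cong (length (filter (_<? x) w) +_) (length-inversions w) ⟨
  length (filter (_<? x) w) + length (inversions w) ∎
  where open ≡-Reasoning

inversions-max : ∀ {x w} → All (_< x) w →
                 length (inversions (x ∷ w)) ≡ length w + length (inversions w)
inversions-max {x} {w} w<x =
  trans (inversions-∷ x w) (cong (λ v → length v + length (inversions w)) (filter-all (_<? x) w<x))

C2-suc : ∀ n → suc n C 2 ≡ n + n C 2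
C2-suc n = trans (sym (nCk+nC[k+1]≡[n+1]C[k+1] n 1)) (cong (_+ n C 2) (nC1≡n n))

-- All pairs of positions are inversions except for one pair inside each summand 12.
layered-inversions : ∀ {N m w} → Layered N m w → length (inversions w) + m ≡ (N + m) C 2
layered-inversions [] = refl
layered-inversions (single {N} {m} {w} l) = begin
  length (inversions (suc (N + m) ∷ w)) + m
    ≡⟨ cong (_+ m) (inversions-max (layered-< l)) ⟩
  length w + length (inversions w) + m
    ≡⟨ cong (λ n → n + length (inversions w) + m) (layered-length l) ⟩
  N + m + length (inversions w) + m
    ≡⟨ +-assoc (N + m) (length (inversions w)) m ⟩
  N + m + (length (inversions w) + m)
    ≡⟨ cong (N + m +_) (layered-inversions l) ⟩
  N + m + (N + m) C 2
    ≡⟨ C2-suc (N + m) ⟨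
  suc (N + m) C 2 ∎
  where open ≡-Reasoning
layered-inversions (double {N} {m} {w} l) = begin
  length (inversions (n ∷ suc n ∷ w)) + suc m
    ≡⟨ cong (_+ suc m) (inversions-∷ n (suc n ∷ w)) ⟩
  length (filter (_<? n) (suc n ∷ w)) + length (inversions (suc n ∷ w)) + suc m
    ≡⟨ cong₂ (λ a b → a + b + suc m) small (inversions-max (All.map m<n⇒m<1+n (layered-< l))) ⟩
  length w + (length w + length (inversions w)) + suc m
    ≡⟨ regroup (length w) (length (inversions w)) m ⟩
  suc (length w) + (length w + (length (inversions w) + m))
    ≡⟨ cong₂ (λ a b → suc a + (a + b)) (layered-length l) (layered-inversions l) ⟩
  n + (N + m + (N + m) C 2)
    ≡⟨ cong (n +_) (C2-suc (N + m)) ⟨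
  n + n C 2
    ≡⟨ C2-suc n ⟨
  suc n C 2
    ≡⟨ cong (λ k → suc k C 2) (+-suc N m) ⟨
  (suc N + suc m) C 2 ∎
  where
  open ≡-Reasoning
  n = suc (N + m)
  small : length (filter (_<? n) (suc n ∷ w)) ≡ length w
  small = cong length (trans (filter-reject (_<? n) (<-asym (n<1+n n)))
                            (filter-all (_<? n) (layered-< l)))
  regroup : ∀ a b m → a + (a + b) + suc m ≡ suc a + (a + (b + m))
  regroup = solve-∀

-- Listing the skew sums with given numbers of summands

-- All skew sums of N permutations, of which m are equal to 12 and the others to 1.  For N + 1
-- summands, the first one is 12 in the words of doubles N m and 1 in the remaining ones, which
-- gives the Pascal recurrence for the length.
layeredWords : ℕ → ℕ → List Word
doubles : ℕ → ℕ → List Word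
layeredWords zero    zero    = [] ∷ []
layeredWords zero    (suc m) = []
layeredWords (suc N) m       = doubles N m ++ map (suc (N + m) ∷_) (layeredWords N m)
doubles N zero    = []
doubles N (suc m) = map (λ w → suc (N + m) ∷ suc (suc (N + m)) ∷ w) (layeredWords N m)

layered-∈ : ∀ {N m w} → Layered N m w → w ∈ layeredWords N m
layered-∈ []                 = here refl
layered-∈ (single {N} {m} l) = ∈-++⁺ʳ (doubles N m) (∈-map⁺ _ (layered-∈ l))
layered-∈ (double l)         = ∈-++⁺ˡ (∈-map⁺ _ (layered-∈ l))

∈-layered : ∀ N m {w} → w ∈ layeredWords N m → Layered N m w
∈-layered zero    zero (here refl) = []
∈-layered (suc N) m    w∈ with ∈-++⁻ (doubles N m) w∈
... | inj₂ w∈s with _ , v∈ , refl ← ∈-map⁻ _ w∈s = single (∈-layered N m v∈)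
∈-layered (suc N) (suc m) w∈ | inj₁ w∈d with _ , v∈ , refl ← ∈-map⁻ _ w∈d =
  double (∈-layered N m v∈)

-- The first entries are N + m in doubles N m and N + m + 1 in the other words.
doubles-singles-disjoint : ∀ N m {w} → w ∈ doubles N m →
                           ¬ w ∈ map (suc (N + m) ∷_) (layeredWords N m)
doubles-singles-disjoint N (suc m) w∈d w∈s
  with _ , _ , refl ← ∈-map⁻ _ w∈d | _ , _ , eq ← ∈-map⁻ _ w∈s =
  m≢1+m+n (N + m) {0} (trans (suc-injective (∷-injectiveˡ eq))
    (trans (+-suc N m) (cong suc (sym (+-identityʳ (N + m))))))

layeredWords-unique : ∀ N m → Unique (layeredWords N m)
layeredWords-unique zero    zero    = [] ∷ []
layeredWords-unique zero    (suc m) = []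
layeredWords-unique (suc N) m       =
  Unique.++⁺ (doubles-unique m) (Unique.map⁺ ∷-injectiveʳ (layeredWords-unique N m))
             (λ (d , s) → doubles-singles-disjoint N m d s)
  where
  doubles-unique : ∀ m → Unique (doubles N m)
  doubles-unique zero    = []
  doubles-unique (suc m) = Unique.map⁺ (∷-injectiveʳ ∘ ∷-injectiveʳ) (layeredWords-unique N m)

layeredWords-length : ∀ N m → length (layeredWords N m) ≡ N C m
layeredWords-length zero    zero    = refl
layeredWords-length zero    (suc m) = sym (k>n⇒nCk≡0 {0} {suc m} z<s)
layeredWords-length (suc N) zero    =
  trans (length-map _ (layeredWords N 0)) (layeredWords-length N 0)
layeredWords-length (suc N) (suc m) = begin
  length (map _ (layeredWords N m) ++ map _ (layeredWords N (suc m)))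
    ≡⟨ length-++ (map _ (layeredWords N m)) ⟩
  length (map _ (layeredWords N m)) + length (map _ (layeredWords N (suc m)))
    ≡⟨ cong₂ _+_ (length-map _ (layeredWords N m)) (length-map _ (layeredWords N (suc m))) ⟩
  length (layeredWords N m) + length (layeredWords N (suc m))
    ≡⟨ cong₂ _+_ (layeredWords-length N m) (layeredWords-length N (suc m)) ⟩
  N C m + N C suc m
    ≡⟨ nCk+nC[k+1]≡[n+1]C[k+1] N m ⟩
  suc N C suc m ∎
  where open ≡-Reasoning

-- The diagonals of the Pascal triangle

-- The successor in the order by n + m and then by n, among pairs with n at least 2.  After the last
-- pair (s , 0) of the diagonal s comes the first pair (2 , s - 1) of the diagonal s + 1.
next : ℕ × ℕ → ℕ × ℕ
next (n , zero)  = 2 , n ∸ 1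
next (n , suc m) = suc n , m

-- The pairs (n , m) with n at least 2, listed by diagonals.
diagonal : ℕ → ℕ × ℕ
diagonal zero    = 2 , 0
diagonal (suc i) = next (diagonal i)

below-trans : ∀ {p q r} → Below p q → Below q r → Below p r
below-trans {n₁ , m₁} {n₂ , m₂} {n₃ , m₃} =
  ×-transitive isEquivalence <-resp₂-≡ <-trans <-trans
    {n₁ + m₁ , n₁} {n₂ + m₂ , n₂} {n₃ + m₃ , n₃}

next-below : ∀ p → Below p (next p)
next-below (zero  , zero)  = inj₁ z<s
next-below (suc n , zero)  = inj₁ (s<s (subst (_< suc n) (sym (+-identityʳ n)) (n<1+n n)))
next-below (n     , suc m) = inj₂ (+-suc n m , n<1+n n)

diagonal-below : ∀ i j → i < j → Below (diagonal i) (diagonal j)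
diagonal-below i (suc j) (s≤s i≤j) with m≤n⇒m<n∨m≡n i≤j
... | inj₁ i<j  = below-trans {diagonal i} {diagonal j} {diagonal (suc j)}
                    (diagonal-below i j i<j) (next-below (diagonal j))
... | inj₂ refl = next-below (diagonal i)

diagonal-≥2 : ∀ i → 2 ≤ proj₁ (diagonal i)
diagonal-≥2 zero    = ≤-refl
diagonal-≥2 (suc i) with diagonal i | diagonal-≥2 i
... | _ , zero  | _   = ≤-refl
... | _ , suc _ | 2≤n = m≤n⇒m≤1+n 2≤n

-- Induction on the diagonal s + 2, and within it on n: the first pair of a diagonal is reached from
-- the last pair of the preceding one.
diagonal-onto : ∀ s n m → n + m ≡ s → ∃[ i ] diagonal i ≡ (2 + n , m)
diagonal-onto zero    zero    m refl = 0 , refl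
diagonal-onto (suc s) zero    m refl with i , eq ← diagonal-onto s s 0 (+-identityʳ s) =
  suc i , cong next eq
diagonal-onto s       (suc n) m eq with i , eq′ ← diagonal-onto s n (suc m) (trans (+-suc n m) eq) =
  suc i , cong next eq′

diagonal-lists : ListsByDiagonals diagonal
diagonal-lists = diagonal-below , λ n m →
  mk⇔ (onto n m) (λ (i , eq) → subst (2 ≤_) (cong proj₁ eq) (diagonal-≥2 i))
  where
  onto : ∀ n m → 2 ≤ n → ∃[ i ] diagonal i ≡ (n , m)
  onto (suc (suc n)) m _ = diagonal-onto (n + m) n m refl
  onto (suc zero) m (s≤s ())

next-C2 : ∀ k n m → 2 ≤ n → k + m ≡ (n + m) C 2 →
          suc k + proj₂ (next (n , m)) ≡ uncurry _+_ (next (n , m)) C 2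
next-C2 k (suc n) zero    _ eq = begin
  suc k + n              ≡⟨ +-comm (suc k) n ⟩
  n + suc k              ≡⟨ +-suc n k ⟩
  suc n + k              ≡⟨ cong (suc n +_) (+-identityʳ k) ⟨
  suc n + (k + 0)        ≡⟨ cong (suc n +_) eq ⟩
  suc n + (suc n + 0) C 2 ≡⟨ cong (λ a → suc n + a C 2) (+-identityʳ (suc n)) ⟩
  suc n + suc n C 2      ≡⟨ C2-suc (suc n) ⟨
  suc (suc n) C 2        ∎
  where open ≡-Reasoning
next-C2 k n (suc m) _ eq = trans (sym (+-suc k m)) (trans eq (cong (_C 2) (+-suc n m)))

-- With N + m as the length, this is the relation between the number of inversions and the pair
-- (N , m) of a skew sum, so position i of the list belongs to i + 1 inversions.
diagonal-C2 : ∀ i → suc i + proj₂ (diagonal i) ≡ uncurry _+_ (diagonal i) C 2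
diagonal-C2 zero    = refl
diagonal-C2 (suc i) = next-C2 (suc i) _ _ (diagonal-≥2 i) (diagonal-C2 i)

-- Indecomposable avoiders with a given number of inversions

-- The number of indecomposable avoiders with k inversions; avoiders lists them.
count : ℕ → ℕ
count zero    = 1
count (suc i) = uncurry _C_ (diagonal i)

avoiders : ℕ → List Word
avoiders zero    = (1 ∷ []) ∷ []
avoiders (suc i) = uncurry layeredWords (diagonal i)

-- A pair is found in the list at the position given by its number of inversions.
diagonal-position : ∀ {k n m} → 2 ≤ n → k + m ≡ (n + m) C 2 →
                    ∃[ i ] k ≡ suc i × diagonal i ≡ (n , m)
diagonal-position {k} {n} {m} 2≤n eq
  with i , refl ← Equivalence.to (proj₂ diagonal-lists n m) 2≤n =
  i , +-cancelʳ-≡ m k (suc i) (trans eq (sym (diagonal-C2 i))) , refl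

layered-I : ∀ {N m w} → Layered N m w → Indecomposable w → I (length (inversions w)) patterns w
layered-I {w = w} l ind =
  subst (λ n → w ↭ 1⋯ n) (sym (layered-length l)) (layered-perm l) , ind , refl ,
  noFarAscent⇒avoids {w} (layered⇒noFarAscent l)

avoiders-sound : ∀ k w → w ∈ avoiders k → I k patterns w
avoiders-sound zero    _ (here refl) = layered-I (single []) [1]-indecomposable
avoiders-sound (suc i) w w∈ = subst (λ k → I k patterns w) k≡ (layered-I l (ind (diagonal-≥2 i) l))
  where
  N = proj₁ (diagonal i)
  m = proj₂ (diagonal i)
  l : Layered N m w
  l = ∈-layered N m w∈
  ind : ∀ {N m w} → 2 ≤ N → Layered N m w → Indecomposable w
  ind (s≤s (s≤s z≤n)) = layered-indecomposable
  k≡ : length (inversions w) ≡ suc i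
  k≡ = +-cancelʳ-≡ m _ _ (trans (layered-inversions l) (sym (diagonal-C2 i)))

layered-∈-avoiders : ∀ {N m w} → Layered (suc (suc N)) m w → w ∈ avoiders (length (inversions w))
layered-∈-avoiders {N} {m} {w} l
  with i , k≡ , d≡ ← diagonal-position {m = m} (s≤s (s≤s z≤n)) (layered-inversions l) =
  subst (λ k → w ∈ avoiders k) (sym k≡)
    (subst (λ p → w ∈ uncurry layeredWords p) (sym d≡) (layered-∈ l))

-- The only decomposable non-empty skew sum of this kind is 12, with the single summand 12.
avoiders-complete : ∀ {N m w} → Layered N m w → Indecomposable w →
                    w ∈ avoiders (length (inversions w))
avoiders-complete [] (w≢[] , _) = contradiction refl w≢[]
avoiders-complete (single []) _ = here refl
avoiders-complete (double []) (_ , ind) = contradiction 12-decomposable ind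
avoiders-complete l@(single (single _)) _ = layered-∈-avoiders l
avoiders-complete l@(single (double _)) _ = layered-∈-avoiders l
avoiders-complete l@(double (single _)) _ = layered-∈-avoiders l
avoiders-complete l@(double (double _)) _ = layered-∈-avoiders l

I-avoiders : ∀ k w → I k patterns w → w ∈ avoiders k
I-avoiders _ w (p , ind , refl , av)
  with _ , _ , l ← noFarAscent⇒layered w p (avoids⇒noFarAscent (perm-unique p) av) =
  avoiders-complete l ind

I-cardinality : ∀ k → HasCardinality (I k patterns) (count k)
I-cardinality k = avoiders k , unique k , (λ w → mk⇔ (avoiders-sound k w) (I-avoiders k w)) , size k
  where
  unique : ∀ k → Unique (avoiders k)
  unique zero    = [] ∷ []
  unique (suc i) = layeredWords-unique (proj₁ (diagonal i)) (proj₂ (diagonal i))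
  size : ∀ k → length (avoiders k) ≡ count k
  size zero    = refl
  size (suc i) = layeredWords-length (proj₁ (diagonal i)) (proj₂ (diagonal i))

-- Sums with at most one non-zero term

sum-zero : ∀ (h f : ℕ → ℕ) n → (∀ i → i < n → h (f i) ≡ 0) → sum (map h (applyUpTo f n)) ≡ 0
sum-zero h f zero    _  = refl
sum-zero h f (suc n) h0 = cong₂ _+_ (h0 0 z<s)
  (sum-zero h (f ∘ suc) n λ i i<n → h0 (suc i) (s<s i<n))

sum-single : ∀ (h f : ℕ → ℕ) {p n} → p < n → (∀ i → i ≢ p → h (f i) ≡ 0) →
             sum (map h (applyUpTo f n)) ≡ h (f p)
sum-single h f {zero}  {suc n} _ h0 =
  trans (cong (h (f 0) +_) (sum-zero h (f ∘ suc) n λ i _ → h0 (suc i) λ ())) (+-identityʳ _)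
sum-single h f {suc p} {suc n} (s<s p<n) h0 =
  cong₂ _+_ (h0 0 λ ()) (sum-single h (f ∘ suc) p<n λ i i≢p → h0 (suc i) (i≢p ∘ suc-injective))

0ₛ-coeff : ∀ k → 0ₛ k ≡ 0
0ₛ-coeff zero    = refl
0ₛ-coeff (suc k) = refl

∑-coeff : ∀ s t F k → ∑ s t F k ≡ sum (map (λ i → F (s + i) k) (upTo (suc t ∸ s)))
∑-coeff s t F k = go (upTo (suc t ∸ s))
  where
  go : ∀ is → foldr (λ n S → F n +ₛ S) 0ₛ (map (s +_) is) k ≡ sum (map (λ i → F (s + i) k) is)
  go []       = 0ₛ-coeff k
  go (i ∷ is) = cong (F (s + i) k +_) (go is)

∑-zero : ∀ s t F k → (∀ n → s ≤ n → n ≤ t → F n k ≡ 0) → ∑ s t F k ≡ 0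
∑-zero s t F k F≡0 = trans (∑-coeff s t F k)
  (sum-zero (λ i → F (s + i) k) id (suc t ∸ s) λ i i< → F≡0 (s + i) (m≤m+n s i) (in-range i i<))
  where
  in-range : ∀ i → i < suc t ∸ s → s + i ≤ t
  in-range i i< = subst (_≤ t) (+-comm i s)
    (s≤s⁻¹ (m≤o∸n⇒m+n≤o (suc i) (<⇒≤ (m∸n≢0⇒n<m (m<n⇒n≢0 i<))) i<))

∑-single : ∀ s t F k {p} → s ≤ p → p ≤ t → (∀ n → s ≤ n → n ≢ p → F n k ≡ 0) →
           ∑ s t F k ≡ F p k
∑-single s t F k s≤p p≤t F≡0 with q , refl ← m≤n⇒∃[o]m+o≡n s≤p =
  trans (∑-coeff s t F k)
    (sum-single (λ i → F (s + i) k) id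
      (m+n≤o⇒m≤o∸n (suc q) (s≤s (subst (_≤ t) (+-comm s q) p≤t)))
      λ i i≢q → F≡0 (s + i) (m≤m+n s i) (i≢q ∘ +-cancelˡ-≡ s i q))

-- Coefficients of products with powers of X

X-off : ∀ i → i ≢ 1 → X i ≡ 0
X-off zero          _   = refl
X-off (suc zero)    i≢1 = contradiction refl i≢1
X-off (suc (suc i)) _   = refl

X*-suc : ∀ g k → (X *ₛ g) (suc k) ≡ g k
X*-suc g k = trans
  (sum-single (λ i → X i * g (suc k ∸ i)) id {1} {suc (suc k)} (s<s z<s) λ i i≢1 →
     cong (_* g (suc k ∸ i)) (X-off i i≢1))
  (*-identityˡ (g k))

X^-diag : ∀ p → (X ^ₛ p) p ≡ 1
X^-diag zero    = refl
X^-diag (suc p) = trans (X*-suc (X ^ₛ p) p) (X^-diag p)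

X^-off : ∀ p k → k ≢ p → (X ^ₛ p) k ≡ 0
X^-off zero    zero    k≢p = contradiction refl k≢p
X^-off zero    (suc k) _   = refl
X^-off (suc p) zero    _   = refl
X^-off (suc p) (suc k) k≢p = trans (X*-suc (X ^ₛ p) k) (X^-off p k (k≢p ∘ cong suc))

X^*-shift : ∀ p g j → ((X ^ₛ p) *ₛ g) (p + j) ≡ g j
X^*-shift p g j = trans
  (sum-single (λ i → (X ^ₛ p) i * g (p + j ∸ i)) id (s≤s (m≤m+n p j))
    λ i i≢p → cong (_* g (p + j ∸ i)) (X^-off p i i≢p))
  (trans (cong₂ _*_ (X^-diag p) (cong g (m+n∸m≡n p j))) (*-identityˡ (g j)))

X^*-zero : ∀ p g k → (∀ j → k ≡ p + j → g j ≡ 0) → ((X ^ₛ p) *ₛ g) k ≡ 0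
X^*-zero p g k g0 = sum-zero (λ i → (X ^ₛ p) i * g (k ∸ i)) id (suc k) term
  where
  term : ∀ i → i < suc k → (X ^ₛ p) i * g (k ∸ i) ≡ 0
  term i i≤k with i ≟ p
  ... | no i≢p   = cong (_* g (k ∸ i)) (X^-off p i i≢p)
  ... | yes refl =
    trans (cong ((X ^ₛ p) p *_) (g0 (k ∸ p) (sym (m+[n∸m]≡n (s≤s⁻¹ i≤k)))))
          (*-zeroʳ ((X ^ₛ p) p))

const*-coeff : ∀ c g k → (const c *ₛ g) k ≡ c * g k
const*-coeff c g k = sum-single (λ i → const c i * g (k ∸ i)) id {0} {suc k} z<s off
  where
  off : ∀ i → i ≢ 0 → const c i * g (k ∸ i) ≡ 0
  off zero    i≢0 = contradiction refl i≢0
  off (suc i) _   = refl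

monomial-diag : ∀ c p → (const c *ₛ (X ^ₛ p)) p ≡ c
monomial-diag c p =
  trans (const*-coeff c (X ^ₛ p) p) (trans (cong (c *_) (X^-diag p)) (*-identityʳ c))

monomial-off : ∀ c p k → k ≢ p → (const c *ₛ (X ^ₛ p)) k ≡ 0
monomial-off c p k k≢p =
  trans (const*-coeff c (X ^ₛ p) k) (trans (cong (c *_) (X^-off p k k≢p)) (*-zeroʳ c))

-- Every series is the sum of its monomials.
power-series : ∀ a → SumsTo 0 (λ k → const (a k) *ₛ (X ^ₛ k)) a
power-series a k = k , λ t k≤t → trans
  (∑-single 0 t (λ k → const (a k) *ₛ (X ^ₛ k)) k z≤n k≤t λ n _ n≢k →
    monomial-off (a n) n k (n≢k ∘ sym))
  (monomial-diag (a k) k)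

-- The generating series

-- The summand of the inner sum for n, with d fixed.
polynomialTerm : ℕ → ℕ → Series
polynomialTerm d n = const (n C (d ∸ n)) *ₛ (X ^ₛ (n ∸ 2))

-- The inner sum: the entries n C (d - n) of the diagonal d, with those for n < 2 left out,
-- as the coefficients of a polynomial in the degrees n - 2.
diagonalPolynomial : ℕ → Series
diagonalPolynomial d = ∑ 2 d (polynomialTerm d)

-- The diagonal d, with its first term moved to degree 1 + (d - 1) C 2.
diagonalSeries : ℕ → Series
diagonalSeries d = (X ^ₛ (1 + ((d ∸ 1) C 2))) *ₛ diagonalPolynomial d

polynomial-coeff : ∀ j m → diagonalPolynomial (2 + j + m) j ≡ (2 + j) C m
polynomial-coeff j m = trans
  (∑-single 2 d (polynomialTerm d) j (s≤s (s≤s z≤n)) (m≤m+n (2 + j) m) off)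
  (trans (monomial-diag ((2 + j) C (d ∸ (2 + j))) j) (cong ((2 + j) C_) (m+n∸m≡n (2 + j) m)))
  where
  d = 2 + j + m
  off : ∀ n → 2 ≤ n → n ≢ 2 + j → polynomialTerm d n j ≡ 0
  off (suc zero)    (s≤s ()) _
  off (suc (suc n)) _        n≢ =
    monomial-off ((2 + n) C (d ∸ (2 + n))) n j λ j≡n → n≢ (cong (2 +_) (sym j≡n))

polynomial-degree : ∀ {d j} → d < 2 + j → diagonalPolynomial d j ≡ 0
polynomial-degree {d} {j} d<2+j = ∑-zero 2 d (polynomialTerm d) j off
  where
  off : ∀ n → 2 ≤ n → n ≤ d → polynomialTerm d n j ≡ 0
  off (suc zero)    (s≤s ()) _
  off (suc (suc n)) _        n≤d =
    monomial-off ((2 + n) C (d ∸ (2 + n))) n j λ { refl → <⇒≱ d<2+j n≤d }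

-- The term of diagonalSeries for the pair (2 + j , m) has degree 1 + (1 + j + m) C 2 + j.  This
-- degree obeys the relation that characterises the position of the pair in the list.
exponent-C2 : ∀ j m → 1 + (1 + j + m) C 2 + j + m ≡ (2 + j + m) C 2
exponent-C2 j m = trans (regroup j m ((1 + j + m) C 2)) (sym (C2-suc (1 + j + m)))
  where
  regroup : ∀ j m c → 1 + c + j + m ≡ 1 + j + m + c
  regroup = solve-∀

-- The coefficient at degree i + 1 comes from the diagonal of the i-th pair, and from no other one.
series-hit : ∀ i → diagonalSeries (uncurry _+_ (diagonal i)) (suc i) ≡ uncurry _C_ (diagonal i)
series-hit i = hit (diagonal i) (diagonal-≥2 i) (diagonal-C2 i)
  where
  hit : ∀ ((n , m) : ℕ × ℕ) → 2 ≤ n → suc i + m ≡ (n + m) C 2 →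
        diagonalSeries (n + m) (suc i) ≡ n C m
  hit (suc (suc j) , m) (s≤s (s≤s z≤n)) i+m =
    trans (cong (diagonalSeries (2 + j + m)) i≡)
      (trans (X^*-shift (1 + (1 + j + m) C 2) (diagonalPolynomial (2 + j + m)) j)
             (polynomial-coeff j m))
    where
    i≡ : suc i ≡ 1 + (1 + j + m) C 2 + j
    i≡ = +-cancelʳ-≡ m _ _ (trans i+m (sym (exponent-C2 j m)))

series-miss : ∀ i d → d ≢ uncurry _+_ (diagonal i) → diagonalSeries d (suc i) ≡ 0
series-miss i d d≢ = X^*-zero (1 + (d ∸ 1) C 2) (diagonalPolynomial d) (suc i) coeff
  where
  coeff : ∀ j → suc i ≡ 1 + (d ∸ 1) C 2 + j → diagonalPolynomial d j ≡ 0
  coeff j eq with 2 + j ≤? d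
  ... | no  2+j≰d = polynomial-degree (≰⇒> 2+j≰d)
  ... | yes 2+j≤d
    with m , refl ← m≤n⇒∃[o]m+o≡n 2+j≤d
    with i′ , refl , d≡ ← diagonal-position {suc i} {2 + j} {m} (s≤s (s≤s z≤n))
                                 (trans (cong (_+ m) eq) (exponent-C2 j m)) =
    contradiction (sym (cong (uncurry _+_) d≡)) d≢

-- The series with the coefficients below degree 2 replaced by 0.
fromDegree2 : Series → Series
fromDegree2 a (suc (suc k)) = a (suc (suc k))
fromDegree2 a _ = 0

1+X+fromDegree2 : ∀ a → a 0 ≡ 1 → a 1 ≡ 1 → ∀ k → ((1ₛ +ₛ X) +ₛ fromDegree2 a) k ≡ a k
1+X+fromDegree2 a a0 a1 zero          = sym a0
1+X+fromDegree2 a a0 a1 (suc zero)    = sym a1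
1+X+fromDegree2 a a0 a1 (suc (suc k)) = refl

diagonal-≥3 : ∀ i → 3 ≤ uncurry _+_ (diagonal (suc i))
diagonal-≥3 i with diagonal-below 0 (suc i) z<s
... | inj₁ 2<n+m       = 2<n+m
... | inj₂ (_ , 2<n) = ≤-trans 2<n (m≤m+n _ _)

diagonalSeries-sum : SumsTo 3 diagonalSeries (fromDegree2 count)
diagonalSeries-sum zero = 0 , λ t _ →
  ∑-zero 3 t diagonalSeries 0 λ d _ _ → X^*-zero (1 + (d ∸ 1) C 2) (diagonalPolynomial d) 0 λ j ()
diagonalSeries-sum (suc zero) = 0 , λ t _ →
  ∑-zero 3 t diagonalSeries 1 λ d 3≤d _ → series-miss 0 d (>⇒≢ 3≤d)
diagonalSeries-sum (suc (suc i)) = uncurry _+_ (diagonal (suc i)) , λ t d≤t → trans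
  (∑-single 3 t diagonalSeries (suc (suc i)) (diagonal-≥3 i) d≤t λ d _ → series-miss (suc i) d)
  (series-hit (suc i))

theorem21 : Σ (ℕ → ℕ) λ a →
    (∀ k → HasCardinality (I k ((1 ∷ 2 ∷ 3 ∷ []) ∷ (1 ∷ 3 ∷ 2 ∷ []) ∷ (2 ∷ 1 ∷ 3 ∷ []) ∷ [])) (a k)) ×
    (a 0 ≡ 1 C 1 ×
    (∃[ e ] ListsByDiagonals e × (∀ k → a (suc k) ≡ proj₁ (e k) C proj₂ (e k)))) ×
    (Σ Series λ T →
    SumsTo 3 (λ d → (X ^ₛ (1 + ((d ∸ 1) C 2))) *ₛ ∑ 2 d (λ n → const (n C (d ∸ n)) *ₛ (X ^ₛ (n ∸ 2)))) T ×
    SumsTo 0 (λ k → const (a k) *ₛ (X ^ₛ k)) ((1ₛ +ₛ X) +ₛ T))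
theorem21 =
  count , I-cardinality , (refl , diagonal , diagonal-lists , λ _ → refl) ,
  fromDegree2 count , diagonalSeries-sum ,
  λ k → proj₁ (power-series count k) , λ t N≤t →
    trans (proj₂ (power-series count k) t N≤t) (sym (1+X+fromDegree2 count refl refl k))
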